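{- Let $\mathbb{M}=\langle V,D,\cdot_{\mathbb{M}}\rangle$ be a $\Sigma$-PNmatrix and let $\mathsf{Ax}\subseteq L_\Sigma(P)$. Define the $\Sigma$-PNmatrix $\mathbb{M}^\flat_{\mathsf{Ax}}=\langle V^\flat_{\mathsf{Ax}},D^\flat_{\mathsf{Ax}},\cdot_{\mathbb{M}^\flat_{\mathsf{Ax}}}\rangle$ by \begin{itemize} \item $V^\flat_{\mathsf{Ax}}=\{(x,A)\in V\times L_\Sigma(P):\text{ if }A\in\mathsf{Ax}^{\mathsf{inst}}\text{ then }x\in D\}$, \item $D^\flat_{\mathsf{Ax}}=D\times L_\Sigma(P)$, \item for each $k\in\mathbb{N}$ and each $k$-place connective $c\in\Sigma^{(k)}$, $$c_{\mathbb{M}^\flat_{\mathsf{Ax}}}((x_1,A_1),\ldots,(x_k,A_k))=\{(x,c(A_1,\dots,A_k))\in V^\flat_{\mathsf{Ax}}:x\in c_{\mathbb{M}}(x_1,\dots,x_k)\}.$$ \end{itemize} Then $\mathbb{M}^\flat_{\mathsf{Ax}}$ is a rexpansion of $\mathbb{M}$, and the consequence relation $\vdash_{\mathbb{M}}^{\mathsf{Ax}}$ is characterized by $\mathbb{M}^\flat_{\mathsf{Ax}}$, that is, $\vdash_{\mathbb{M}}^{\mathsf{Ax}}\;=\;\vdash_{\mathbb{M}^\flat_{\mathsf{Ax}}}$.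
   Context: A signature $\Sigma$ is a family $\{\Sigma^{(k)}\}_{k\in\mathbb{N}}$ of sets, $\Sigma^{(k)}$ being the set of $k$-place connectives. $L_\Sigma(P)$ is the set of formulas (the absolutely free $\Sigma$-algebra) over a fixed denumerable set $P$ of sentential variables. A substitution is a function $\sigma:P\to L_\Sigma(P)$; $A^\sigma$ is the result of applying (the endomorphism extending) $\sigma$ to $A$. For $\Gamma\subseteq L_\Sigma(P)$, $\Gamma^{\mathsf{inst}}=\{A^\sigma: A\in\Gamma,\ \sigma:P\to L_\Sigma(P)\}$. A $\Sigma$-PNmatrix (partial non-deterministic matrix) is $\mathbb{M}=\langle V,D,\cdot_{\mathbb{M}}\rangle$ with $V$ a set (truth-values), $D\subseteq V$ (designated values), and, for each $k$ and each $c\in\Sigma^{(k)}$, a function $c_{\mathbb{M}}:V^k\to\wp(V)$ (the empty set is an allowed output). An $\mathbb{M}$-valuation is a function $v:L_\Sigma(P)\to V$ with $v(c(A_1,\dots,A_k))\in c_{\mathbb{M}}(v(A_1),\dots,v(A_k))$ for all $k$, all $c\in\Sigma^{(k)}$ and all formulas $A_1,\dots,A_k$; $\mathrm{Val}_{\mathbb{M}}$ is the set of all $\mathbb{M}$-valuations. The consequence relation characterized by $\mathbb{M}$ is: $\Gamma\vdash_{\mathbb{M}}A$ iff for every $v\in\mathrm{Val}_{\mathbb{M}}$, $v(\Gamma)\subseteq D$ implies $v(A)\in D$. The strengthening of $\vdash_{\mathbb{M}}$ with (schema) axioms $\mathsf{Ax}$ is the relation: $\Gamma\vdash_{\mathbb{M}}^{\mathsf{Ax}}A$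 iff $\Gamma\cup\mathsf{Ax}^{\mathsf{inst}}\vdash_{\mathbb{M}}A$. Rexpansions: a refinement of $\mathbb{M}=\langle V,D,\cdot_{\mathbb{M}}\rangle$ is any $\Sigma$-PNmatrix $\mathbb{M}'=\langle V',D',\cdot_{\mathbb{M}'}\rangle$ with $V'\subseteq V$, $D'=D\cap V'$ and $c_{\mathbb{M}'}(x_1,\dots,x_k)\subseteq c_{\mathbb{M}}(x_1,\dots,x_k)$ for all $c\in\Sigma^{(k)}$ and $x_1,\dots,x_k\in V'$. An expansion function is $\mathcal{E}:V\to\wp(U)$ (for some set $U$) with $\mathcal{E}(x)\neq\emptyset$ for all $x\in V$ and $\mathcal{E}(x)\cap\mathcal{E}(x')=\emptyset$ for $x\neq x'$; put $\mathcal{E}(X)=\bigcup_{x\in X}\mathcal{E}(x)$ for $X\subseteq V$, and let $\widetilde{\mathcal{E}}:\mathcal{E}(V)\to V$ send $y$ to the unique $x$ with $y\in\mathcal{E}(x)$. The $\mathcal{E}$-expansion of $\mathbb{M}$ is $\mathcal{E}(\mathbb{M})=\langle\mathcal{E}(V),\mathcal{E}(D),\cdot_{\mathcal{E}(\mathbb{M})}\rangle$ with $c_{\mathcal{E}(\mathbb{M})}(y_1,\dots,y_k)=\mathcal{E}(c_{\mathbb{M}}(\widetilde{\mathcal{E}}(y_1),\dots,\widetilde{\mathcal{E}}(y_k)))$. A rexpansion of $\mathbb{M}$ is a refinement of some $\mathcal{E}$-expansion of $\mathbb{M}$. -}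

module Defs where

open import Level using (Level; suc)
open import Data.Nat.Base using (ℕ)
open import Data.Product using (_×_; _,_; proj₁; proj₂; ∃; ∃₂; Σ-syntax)
open import Data.Vec.Base using (Vec; []; _∷_; map)
open import Data.Vec.Relation.Unary.All using (All; []; _∷_; reduce)
open import Function.Bundles using (_↔_)
open import Relation.Binary.PropositionalEquality using (_≡_; _≢_)
open import Relation.Unary using (Pred; _∈_; _⊆_; _∩_; _∪_; _≐_; Satisfiable; Empty)

private variable
  ℓ : Level

Signature : (ℓ : Level) → Set (suc ℓ)
Signature ℓ = ℕ → Set ℓ

Denumerable : Set ℓ → Set ℓ
Denumerable P = P ↔ ℕ

data Formula (Sig : Signature ℓ) (P : Set ℓ) : Set ℓ where
  var : P → Formula Sig P
  app : ∀ {k} → Sig k → Vec (Formula Sig P) k → Formula Sig P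

module _ {Sig : Signature ℓ} {P : Set ℓ} where

  mutual
    _⟨_⟩ : Formula Sig P → (P → Formula Sig P) → Formula Sig P
    var p    ⟨ σ ⟩ = σ p
    app c As ⟨ σ ⟩ = app c (As ⟨ σ ⟩*)

    _⟨_⟩* : ∀ {k} → Vec (Formula Sig P) k → (P → Formula Sig P) → Vec (Formula Sig P) k
    []       ⟨ σ ⟩* = []
    (A ∷ As) ⟨ σ ⟩* = A ⟨ σ ⟩ ∷ As ⟨ σ ⟩*

  _inst : Pred (Formula Sig P) ℓ → Pred (Formula Sig P) ℓ
  (Γ inst) B = ∃₂ λ A σ → A ∈ Γ × B ≡ A ⟨ σ ⟩

-- Sets of truth-values are subsets of an ambient type U, so that V′ ⊆ V makes
-- sense for two different PNmatrices.  The interpretation of a connective is a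
-- function V^k → ℘(V): `op` is total on Vec U k only for convenience, and its
-- outputs on tuples that are not in V^k carry no meaning.
record PNmatrix (Sig : Signature ℓ) (U : Set ℓ) : Set (suc ℓ) where
  field
    V    : Pred U ℓ
    D    : Pred U ℓ
    D⊆V  : D ⊆ V
    op   : ∀ {k} → Sig k → Vec U k → Pred U ℓ
    op⊆V : ∀ {k} (c : Sig k) {xs : Vec U k} → All V xs → op c xs ⊆ V

module _ {Sig : Signature ℓ} {U : Set ℓ} where

  record IsValuation {P : Set ℓ} (M : PNmatrix Sig U) (v : Formula Sig P → U) : Set ℓ where
    open PNmatrix M
    field
      v∈V  : ∀ A → v A ∈ V
      v-op : ∀ {k} (c : Sig k) (As : Vec (Formula Sig P) k) → v (app c As) ∈ op c (map v As)

  Consequence : {P : Set ℓ} → PNmatrix Sig U → Pred (Formula Sig P) ℓ → Formula Sig P → Set ℓ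
  Consequence {P} M Γ A =
    (v : Formula Sig P → U) → IsValuation M v → (∀ {B} → B ∈ Γ → v B ∈ D) → v A ∈ D
    where open PNmatrix M

  syntax Consequence M Γ A = Γ ⊢[ M ] A

  Strengthening : {P : Set ℓ} → PNmatrix Sig U → Pred (Formula Sig P) ℓ →
                  Pred (Formula Sig P) ℓ → Formula Sig P → Set ℓ
  Strengthening M Ax Γ A = (Γ ∪ Ax inst) ⊢[ M ] A

  syntax Strengthening M Ax Γ A = Γ ⊢[ M ⊕ Ax ] A

  record IsRefinement (M M′ : PNmatrix Sig U) : Set ℓ where
    private
      module M  = PNmatrix M
      module M′ = PNmatrix M′
    field
      V′⊆V   : M′.V ⊆ M.V
      D′≐D∩V′ : M′.D ≐ (M.D ∩ M′.V)
      op′⊆op : ∀ {k} (c : Sig k) {xs : Vec U k} → All M′.V xs → M′.op c xs ⊆ M.op c xs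

-- A function V → ℘(W), for V a subset of U; its values outside V carry no meaning.
record ExpansionFunction {U : Set ℓ} (V : Pred U ℓ) (W : Set ℓ) : Set (suc ℓ) where
  field
    E        : U → Pred W ℓ
    nonempty : ∀ {x} → x ∈ V → Satisfiable (E x)
    -- Disjointness of E x and E x′ for x ≢ x′, in the positive form that makes
    -- "the unique x with y ∈ E x" well defined constructively.
    unique   : ∀ {x x′ y} → x ∈ V → x′ ∈ V → y ∈ E x → y ∈ E x′ → x ≡ x′

  disjoint : ∀ {x x′} → x ∈ V → x′ ∈ V → x ≢ x′ → Empty (E x ∩ E x′)
  disjoint x∈V x′∈V x≢x′ y (y∈Ex , y∈Ex′) = x≢x′ (unique x∈V x′∈V y∈Ex y∈Ex′)

  E[_] : Pred U ℓ → Pred W ℓ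
  E[ X ] y = ∃ λ x → x ∈ X × y ∈ E x

  Ẽ : ∀ {y} → y ∈ E[ V ] → U
  Ẽ (x , _) = x

module _ {Sig : Signature ℓ} {U W : Set ℓ} where

  expansion : (M : PNmatrix Sig U) → ExpansionFunction (PNmatrix.V M) W → PNmatrix Sig W
  expansion M 𝓔 = record
    { V    = E[ V ]
    ; D    = E[ D ]
    ; D⊆V  = λ (x , x∈D , y∈Ex) → x , D⊆V x∈D , y∈Ex
    ; op   = λ c ys y → Σ[ ys∈E[V] ∈ All E[ V ] ys ] y ∈ E[ op c (reduce Ẽ ys∈E[V]) ]
    ; op⊆V = λ c _ (ys∈E[V] , x , x∈op , y∈Ex) → x , op⊆V c (Ẽ∈V ys∈E[V]) x∈op , y∈Ex
    }
    where
    open PNmatrix M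
    open ExpansionFunction 𝓔
    Ẽ∈V : ∀ {k} {ys : Vec W k} (ys∈E[V] : All E[ V ] ys) → All V (reduce Ẽ ys∈E[V])
    Ẽ∈V []                     = []
    Ẽ∈V ((_ , x∈V , _) ∷ rest) = x∈V ∷ Ẽ∈V rest

  -- The codomain ℘(W) of the expansion function is over the ambient type W of
  -- the candidate rexpansion M′.
  IsRexpansion : PNmatrix Sig U → PNmatrix Sig W → Set (suc ℓ)
  IsRexpansion M M′ =
    Σ[ 𝓔 ∈ ExpansionFunction (PNmatrix.V M) W ] IsRefinement (expansion M 𝓔) M′

module _ {Sig : Signature ℓ} {P U : Set ℓ} where

  _♭_ : PNmatrix Sig U → Pred (Formula Sig P) ℓ → PNmatrix Sig (U × Formula Sig P)
  M ♭ Ax = record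
    { V    = V♭
    ; D    = λ (x , A) → x ∈ D
    ; D⊆V  = λ x∈D → D⊆V x∈D , λ _ → x∈D
    ; op   = λ c xAs (x , A) →
               (x , A) ∈ V♭ × x ∈ op c (map proj₁ xAs) × A ≡ app c (map proj₂ xAs)
    ; op⊆V = λ _ _ → proj₁
    }
    where
    open PNmatrix M
    V♭ : Pred (U × Formula Sig P) ℓ
    V♭ (x , A) = x ∈ V × (A ∈ Ax inst → x ∈ D)

{-# OPTIONS --safe #-}
module Submission where

open import Level using (Level)
open import Data.Product using (_×_; _,_; proj₁; proj₂)
open import Data.Sum.Base using (inj₁; inj₂; [_,_])
open import Data.Vec.Base using (Vec; []; _∷_; map)
open import Data.Vec.Properties using (map-∘; map-id)
open import Data.Vec.Relation.Unary.All as All using (All; []; _∷_; reduce)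
open import Function.Base using (_∘_)
open import Function.Bundles using (_⇔_; mk⇔; Inverse)
open import Relation.Binary.PropositionalEquality
  using (_≡_; refl; sym; trans; cong; cong₂; subst)
open import Relation.Unary using (Pred; _∈_; _⊆_)
open import Defs

-- Expand every x to {x} × L_Σ(P).  The formula components of a valuation v of
-- M ♭ Ax form an endomorphism of the formula algebra, that is, a substitution
-- σ; as Ax inst is closed under σ, the first components of v designate
-- Ax inst.  Conversely, a valuation v of M designating Ax inst lifts to
-- A ↦ (v A , A).

private variable
  ℓ : Level

module _ {Sig : Signature ℓ} {P : Set ℓ} where

  mutual
    ⟨⟩-∘ : (τ σ : P → Formula Sig P) (A : Formula Sig P) →
           A ⟨ τ ⟩ ⟨ σ ⟩ ≡ A ⟨ (λ p → τ p ⟨ σ ⟩) ⟩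
    ⟨⟩-∘ τ σ (var p)    = refl
    ⟨⟩-∘ τ σ (app c As) = cong (app c) (⟨⟩*-∘ τ σ As)

    ⟨⟩*-∘ : ∀ {k} (τ σ : P → Formula Sig P) (As : Vec (Formula Sig P) k) →
            As ⟨ τ ⟩* ⟨ σ ⟩* ≡ As ⟨ (λ p → τ p ⟨ σ ⟩) ⟩*
    ⟨⟩*-∘ τ σ []       = refl
    ⟨⟩*-∘ τ σ (A ∷ As) = cong₂ _∷_ (⟨⟩-∘ τ σ A) (⟨⟩*-∘ τ σ As)

  -- Applying `τ` and then `σ` is again a single substitution, so the axiom `A` is kept as witness
  -- and the two substitutions are composed.
  inst-closed : (Ax : Pred (Formula Sig P) ℓ) (σ : P → Formula Sig P) →
                ∀ {B} → B ∈ Ax inst → B ⟨ σ ⟩ ∈ Ax inst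
  inst-closed Ax σ (A , τ , A∈Ax , refl) =
    A , (λ p → τ p ⟨ σ ⟩) , A∈Ax , ⟨⟩-∘ τ σ A

  module _ (h : Formula Sig P → Formula Sig P)
           (h-app : ∀ {k} (c : Sig k) As → h (app c As) ≡ app c (map h As)) where

    mutual
      -- Both sides are endomorphisms that agree on variables, and the formula algebra is absolutely
      -- free.
      endomorphism≡⟨⟩ : ∀ A → h A ≡ A ⟨ h ∘ var ⟩
      endomorphism≡⟨⟩ (var p)    = refl
      endomorphism≡⟨⟩ (app c As) = trans (h-app c As) (cong (app c) (map-endomorphism≡⟨⟩* As))

      map-endomorphism≡⟨⟩* : ∀ {k} (As : Vec (Formula Sig P) k) → map h As ≡ As ⟨ h ∘ var ⟩*
      map-endomorphism≡⟨⟩* []       = refl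
      map-endomorphism≡⟨⟩* (A ∷ As) =
        cong₂ _∷_ (endomorphism≡⟨⟩ A) (map-endomorphism≡⟨⟩* As)

module _ {Sig : Signature ℓ} {P U : Set ℓ} (M : PNmatrix Sig U) (Ax : Pred (Formula Sig P) ℓ) where

  open PNmatrix M
  private module M♭ = PNmatrix (M ♭ Ax)

  -- The formula A₀ only witnesses that L_Σ(P) is inhabited.
  fibres : Formula Sig P → ExpansionFunction V (U × Formula Sig P)
  fibres A₀ = record
    { E        = λ x (y , _) → x ≡ y
    ; nonempty = λ {x} _ → (x , A₀) , refl
    ; unique   = λ _ _ x≡y x′≡y → trans x≡y (sym x′≡y)
    }

  ♭-isRexpansion : Formula Sig P → IsRexpansion M (M ♭ Ax)
  ♭-isRexpansion A₀ = fibres A₀ , record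
    { V′⊆V    = V♭⊆E[V]
    ; D′≐D∩V′ = (λ x∈D → (_ , x∈D , refl) , M♭.D⊆V x∈D)
              , (λ { ((_ , x∈D , refl) , _) → x∈D })
    -- The expansion constrains only the first component of an output; the refinement also fixes its
    -- formula.
    ; op′⊆op  = λ c xAs∈V♭ (_ , x∈op , _) →
        let xAs∈E[V] = All.map V♭⊆E[V] xAs∈V♭ in
        xAs∈E[V] , _ , subst (λ xs → _ ∈ op c xs) (sym (reduce-Ẽ xAs∈E[V])) x∈op , refl
    }
    where
    open ExpansionFunction (fibres A₀) using (E[_]; Ẽ)

    V♭⊆E[V] : M♭.V ⊆ E[ V ]
    V♭⊆E[V] (x∈V , _) = _ , x∈V , refl

    -- Matching `y ∈ E x` with `refl` turns `Ẽ` into the first projection, which is how `M ♭ Ax`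
    -- reads its arguments.
    reduce-Ẽ : ∀ {k} {ys : Vec (U × Formula Sig P) k} (ys∈E[V] : All E[ V ] ys) →
               reduce (λ {y} → Ẽ {y}) ys∈E[V] ≡ map proj₁ ys
    reduce-Ẽ []                         = refl
    reduce-Ẽ ((x , _ , refl) ∷ ys∈E[V]) = cong (x ∷_) (reduce-Ẽ ys∈E[V])

  module _ {v : Formula Sig P → U × Formula Sig P} (v-val : IsValuation (M ♭ Ax) v) where

    open IsValuation v-val

    proj₁-isValuation : IsValuation M (proj₁ ∘ v)
    proj₁-isValuation = record
      { v∈V  = proj₁ ∘ v∈V
      ; v-op = λ c As →
          subst (λ xs → _ ∈ op c xs) (sym (map-∘ proj₁ v As)) (proj₁ (proj₂ (v-op c As)))
      }

    -- The operations of `M ♭ Ax` force the formula component of every output. It need not be the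
    -- formula being valued, since variables may carry any formula.
    proj₂-app : ∀ {k} (c : Sig k) As → proj₂ (v (app c As)) ≡ app c (map (proj₂ ∘ v) As)
    proj₂-app c As =
      trans (proj₂ (proj₂ (v-op c As))) (cong (app c) (sym (map-∘ proj₂ v As)))

    ♭-designates-inst : ∀ {B} → B ∈ Ax inst → proj₁ (v B) ∈ D
    -- The value `v B` carries `B ⟨ σ ⟩` with `σ = proj₂ ∘ v ∘ var`. This is an instance of an
    -- axiom, so membership in `M♭.V` makes its first component designated.
    ♭-designates-inst {B} B∈inst = proj₂ (v∈V B)
      (subst (_∈ Ax inst) (sym (endomorphism≡⟨⟩ (proj₂ ∘ v) proj₂-app B))
        (inst-closed Ax _ B∈inst))

  lift-isValuation : ∀ {v} → IsValuation M v → (∀ {B} → B ∈ Ax inst → v B ∈ D) →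
                     IsValuation (M ♭ Ax) (λ A → v A , A)
  lift-isValuation {v} v-val v-inst = record
    { v∈V  = lift∈V♭
    ; v-op = λ c As →
        lift∈V♭ (app c As)
      , subst (λ xs → _ ∈ op c xs) (map-∘ proj₁ (λ A → v A , A) As) (v-op c As)
      , cong (app c) (trans (sym (map-id As)) (map-∘ proj₂ (λ A → v A , A) As))
    }
    where
    open IsValuation v-val
    lift∈V♭ : ∀ A → (v A , A) ∈ M♭.V
    -- With `A` itself as second component, the side condition on pairs is exactly `v-inst`.
    lift∈V♭ A = v∈V A , v-inst

  ♭-characterizes : (Γ : Pred (Formula Sig P) ℓ) (A : Formula Sig P) →
                    (Γ ⊢[ M ⊕ Ax ] A) ⇔ (Γ ⊢[ M ♭ Ax ] A)
  ♭-characterizes Γ A = mk⇔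
    (λ Γ⊢A v v-val v-Γ →
      Γ⊢A (proj₁ ∘ v) (proj₁-isValuation v-val) [ v-Γ , ♭-designates-inst v-val ])
    (λ Γ⊢A v v-val v-Γ∪inst →
      Γ⊢A (λ B → v B , B) (lift-isValuation v-val (λ {B} B∈inst → v-Γ∪inst {B} (inj₂ B∈inst)))
        (λ {B} B∈Γ → v-Γ∪inst {B} (inj₁ B∈Γ)))

theorem3p2 : {ℓ : Level} (Sig : Signature ℓ) (P : Set ℓ) → Denumerable P →
    (U : Set ℓ) (M : PNmatrix Sig U) (Ax : Pred (Formula Sig P) ℓ) →
    IsRexpansion M (M ♭ Ax) ×
    ((Γ : Pred (Formula Sig P) ℓ) (A : Formula Sig P) →
    (Γ ⊢[ M ⊕ Ax ] A) ⇔ (Γ ⊢[ M ♭ Ax ] A))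
theorem3p2 Sig P P↔ℕ U M Ax =
  -- Denumerability supplies a variable, hence a formula to make the fibres nonempty.
  ♭-isRexpansion M Ax (var (Inverse.from P↔ℕ 0)) , ♭-characterizes M Ax
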